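{- For every integer $t\geq 1$, every graph $G$ that does not contain $K^*_{3,t}$ as a minor satisfies, for every integer $r\geq 1$, \[\mathrm{scol}_r(G)\leq 3(2t+1)(2r+1)\quad\text{and}\quad \mathrm{wcol}_r(G)\leq (2t+1)\binom{r+2}{2}(2r+1).\]
   Context: All graphs are finite and simple. $K^*_{3,t}$ is the complete join of $K_3$ and $\overline{K_t}$. For a graph $G$, a linear ordering $\preceq$ of $V(G)$, a vertex $v$ and an integer $r\geq 1$: $S_r(G,\preceq,v)$ is the set of vertices $x$ for which there is a path $v=w_0,w_1,\dots,w_{r'}=x$ with $0\le r'\le r$, $x\preceq v$ and $v\prec w_i$ for all $1\le i\le r'-1$; $W_r(G,\preceq,v)$ is the set of vertices $x$ for which there is such a path with $x\preceq v$ and $x\prec w_i$ for all $1\le i\le r'-1$. $\mathrm{scol}_r(G)$ is the minimum $k$ such that some linear ordering $\preceq$ satisfies $|S_r(G,\preceq,v)|\le k$ for all $v$; $\mathrm{wcol}_r(G)$ is the minimum $k$ such that some linear ordering satisfies $|W_r(G,\preceq,v)|\le k$ for all $v$. -}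

module Defs where

open import Data.Nat using (ℕ; suc; _≤_; _<_; _+_; _<ᵇ_)
open import Data.Fin using (Fin; toℕ; _≟_)
open import Data.Bool using (Bool; T; not; _∧_; _∨_; true)
open import Data.Bool.Properties using (∨-comm)
open import Data.Empty using (⊥-elim)
open import Data.List using (List; []; _∷_; _++_; [_]; length)
open import Data.List.Relation.Unary.All using (All)
open import Data.List.Relation.Unary.Linked using (Linked)
open import Data.List.Relation.Unary.Unique.Propositional using (Unique)
open import Data.Product using (Σ; ∃; _×_)
open import Data.Sum using (_⊎_)
open import Relation.Nullary using (¬_; does; yes; no)
open import Relation.Binary.PropositionalEquality using (_≡_; refl; cong)
open import Function.Definitions using (Injective)

record Graph (n : ℕ) : Set where
  field
    adj    : Fin n → Fin n → Bool
    sym    : ∀ u v → adj u v ≡ adj v u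
    irrefl : ∀ u → ¬ T (adj u u)

module _ {n : ℕ} (G : Graph n) where
  Adj : Fin n → Fin n → Set
  Adj u v = T (Graph.adj G u v)

  ConnectedWithin : (Fin n → Set) → Fin n → Fin n → Set
  ConnectedWithin P x y =
    (x ≡ y) ⊎ Σ (List (Fin n)) (λ mid → Linked Adj (x ∷ mid ++ [ y ]) × All P mid)

  -- x reachable from v by a path v = w₀, w₁, …, w_{r'} = x with 0 ≤ r' ≤ r,
  -- (distinct vertices) whose interior vertices w₁ … w_{r'-1} all satisfy P.
  -- r' = 0 is the case x ≡ v; otherwise the interior is mid and r' = length mid + 1.
  PathReach : (Fin n → Set) → ℕ → Fin n → Fin n → Set
  PathReach P r v x =
    (x ≡ v) ⊎
    Σ (List (Fin n)) (λ mid →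
        (suc (length mid) ≤ r)
      × Linked Adj (v ∷ mid ++ [ x ])
      × Unique (v ∷ mid ++ [ x ])
      × All P mid)

record IsMinor {h n : ℕ} (H : Graph h) (G : Graph n) : Set₁ where
  field
    branch    : Fin h → Fin n → Set
    nonempty  : ∀ i → ∃ (branch i)
    disjoint  : ∀ i j x → branch i x → branch j x → i ≡ j
    connected : ∀ i x y → branch i x → branch i y → ConnectedWithin G (branch i) x y
    edges     : ∀ i j → Adj H i j →
                Σ (Fin n) (λ x → Σ (Fin n) (λ y → branch i x × branch j y × Adj G x y))

-- K*_{3,t}: vertices 0,1,2 form the K₃, vertices 3 … t+2 the independent set.
-- u ~ v  iff  u ≠ v and (u < 3 or v < 3).
K3t*-adj : (t : ℕ) → Fin (3 + t) → Fin (3 + t) → Bool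
K3t*-adj t u v = not (does (u ≟ v)) ∧ ((toℕ u <ᵇ 3) ∨ (toℕ v <ᵇ 3))

K3t*-sym : (t : ℕ) → ∀ u v → K3t*-adj t u v ≡ K3t*-adj t v u
K3t*-sym t u v with u ≟ v | v ≟ u
... | yes refl | yes _ = refl
... | yes refl | no ne = ⊥-elim (ne refl)
... | no ne | yes refl = ⊥-elim (ne refl)
... | no _ | no _ = cong (λ b → true ∧ b) (∨-comm (toℕ u <ᵇ 3) (toℕ v <ᵇ 3))

K3t*-irrefl : (t : ℕ) → ∀ u → ¬ T (K3t*-adj t u u)
K3t*-irrefl t u p with u ≟ u
... | yes _ = p
... | no ne = ne refl

K3t* : (t : ℕ) → Graph (3 + t)
K3t* t = record { adj = K3t*-adj t ; sym = K3t*-sym t ; irrefl = K3t*-irrefl t }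

record Ordering (n : ℕ) : Set where
  field
    rank : Fin n → Fin n
    rank-injective : Injective _≡_ _≡_ rank

module _ {n : ℕ} (σ : Ordering n) where
  _⪯_ : Fin n → Fin n → Set
  x ⪯ y = toℕ (Ordering.rank σ x) ≤ toℕ (Ordering.rank σ y)

  _≺_ : Fin n → Fin n → Set
  x ≺ y = toℕ (Ordering.rank σ x) < toℕ (Ordering.rank σ y)

SReach : {n : ℕ} → Graph n → Ordering n → ℕ → Fin n → Fin n → Set
SReach G σ r v x = _⪯_ σ x v × PathReach G (λ w → _≺_ σ v w) r v x

WReach : {n : ℕ} → Graph n → Ordering n → ℕ → Fin n → Fin n → Set
WReach G σ r v x = _⪯_ σ x v × PathReach G (λ w → _≺_ σ x w) r v x

CardAtMost : {n : ℕ} → (Fin n → Set) → ℕ → Set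
CardAtMost {n} P k = ∀ (xs : List (Fin n)) → Unique xs → All P xs → length xs ≤ k

-- scol_r(G) ≤ k  and  wcol_r(G) ≤ k  (scol/wcol are minima over orderings)
scol≤ : {n : ℕ} → Graph n → ℕ → ℕ → Set
scol≤ {n} G r k = Σ (Ordering n) (λ σ → ∀ v → CardAtMost (SReach G σ r v) k)

wcol≤ : {n : ℕ} → Graph n → ℕ → ℕ → Set
wcol≤ {n} G r k = Σ (Ordering n) (λ σ → ∀ v → CardAtMost (WReach G σ r v) k)

{-# OPTIONS --safe #-}

-- Cut the graph into pieces one after another so that every component K of what remains sees at
-- most two pieces, contained in disjoint connected sets Y₁, Y₂ outside K that are adjacent whenever
-- K sees both. If K sees both, take a BFS tree of K and a minimal rooted subtree X for which no
-- component of K − X sees both Y₁ and Y₂. By minimality every leaf of X is adjacent to Y₁ together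
-- with the components of K − X seeing it, and likewise for Y₂. Contracting these two sets and
-- X minus t of its leaves turns t + 1 non-root leaves into a K*_{3,t} minor. Hence X is covered by at
-- most t root-to-leaf paths and the root; as these follow BFS levels, a ball of radius r meets each
-- of them in at most 2r + 1 vertices. A component of K − X sees X and at most one of the two old
-- pieces, so the pieces form a 2-tree-like structure, in which at most C(r + 2, 2) pieces are weakly
-- r-reachable and at most 3 are strongly reachable.
module Submission where

open import Defs
open import Data.Nat using (ℕ; zero; suc; _≤_; _<_; _+_; _*_; _∸_; z≤n; s≤s)
open import Data.Nat.Properties
open import Data.Nat.Combinatorics using (_C_; nC1≡n; nCk+nC[k+1]≡[n+1]C[k+1])
open import Data.Nat.Induction using (<-wellFounded)
open import Induction.WellFounded using (Acc; acc)
open import Data.Bool using (Bool; true; false; T)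
open import Data.Bool.Properties using (T?; ∧-zeroʳ)
open import Data.Fin using (Fin; zero; suc; toℕ; fromℕ<; inject≤) renaming (_≟_ to _≟ᶠ_)
open import Data.Fin.Properties using (any?; toℕ<n; toℕ-injective; toℕ-fromℕ<; inject≤-injective)
open import Data.List using (List; []; _∷_; _++_; [_]; length; filter; allFin; map; concatMap; upTo; cartesianProductWith; lookup)
open import Data.List.Properties using (length-++; length-map; length-upTo; length-filter; length-tabulate)
open import Data.List.Membership.Propositional using (_∈_)
open import Data.List.Membership.Propositional.Properties
open import Data.List.Relation.Unary.Any using (here; there)
import Data.List.Relation.Unary.Any as Any
open import Data.List.Relation.Unary.All using (All; []; _∷_)
import Data.List.Relation.Unary.All as All
open import Data.List.Relation.Unary.AllPairs using ([]; _∷_)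
open import Data.List.Relation.Unary.Linked using (Linked; [-]; _∷_)
open import Data.List.Relation.Unary.Unique.Propositional using (Unique)
import Data.List.Relation.Unary.Unique.Propositional.Properties as Uniqueₚ
open import Data.Product using (Σ; ∃; ∃-syntax; _×_; _,_; proj₁; proj₂)
open import Data.Sum using (_⊎_; inj₁; inj₂; swap)
open import Data.Empty using (⊥; ⊥-elim)
open import Data.Unit using (⊤; tt)
open import Function using (_∘_; id)
open import Relation.Nullary using (¬_; Dec; yes; no; contradiction)
open import Relation.Nullary.Decidable using (_×-dec_; _⊎-dec_; ¬?; decidable-stable)
open import Relation.Unary using (Decidable)
open import Relation.Binary.Definitions using (tri<; tri≈; tri>)
open import Relation.Binary.PropositionalEquality using (_≡_; _≢_; refl; sym; trans; cong; cong₂; subst; subst₂; module ≡-Reasoning)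

-- Counting with duplicate-free lists.

module _ {A : Set} where

  remove : ∀ {x : A} ys {zs y} → y ∈ ys ++ x ∷ zs → x ≢ y → y ∈ ys ++ zs
  remove []       (here y≡x)  x≢y = contradiction (sym y≡x) x≢y
  remove []       (there y∈)  x≢y = y∈
  remove (_ ∷ ys) (here y≡)   x≢y = here y≡
  remove (_ ∷ ys) (there y∈)  x≢y = there (remove ys y∈ x≢y)

  unique-length-≤ : ∀ {xs ys : List A} → Unique xs → All (_∈ ys) xs → length xs ≤ length ys
  unique-length-≤ [] [] = z≤n
  unique-length-≤ {x ∷ xs} (x∉xs ∷ uniq) (x∈ys ∷ xs⊆ys) with ∈-∃++ x∈ys
  ... | as , bs , refl = begin
    suc (length xs)             ≤⟨ s≤s (unique-length-≤ uniq
                                     (All.zipWith (λ (y∈ , x≢y) → remove as y∈ x≢y) (xs⊆ys , x∉xs))) ⟩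
    suc (length (as ++ bs))     ≡⟨ cong suc (length-++ as) ⟩
    suc (length as + length bs) ≡⟨ +-suc (length as) (length bs) ⟨
    length as + suc (length bs) ≡⟨ length-++ as ⟨
    length (as ++ x ∷ bs)       ∎
    where open ≤-Reasoning

  unique-lookup-injective : ∀ {xs : List A} → Unique xs → ∀ i j → lookup xs i ≡ lookup xs j → i ≡ j
  unique-lookup-injective (_ ∷ _)    zero    zero    _  = refl
  unique-lookup-injective (x∉ ∷ _)   zero    (suc j) eq = contradiction eq (All.lookup x∉ (∈-lookup j))
  unique-lookup-injective (x∉ ∷ _)   (suc i) zero    eq = contradiction (sym eq) (All.lookup x∉ (∈-lookup i))
  unique-lookup-injective (_ ∷ uniq) (suc i) (suc j) eq = cong suc (unique-lookup-injective uniq i j eq)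

  length-cartesianProductWith : ∀ {B C : Set} (f : B → C → A) xs ys →
    length (cartesianProductWith f xs ys) ≡ length xs * length ys
  length-cartesianProductWith f []       ys = refl
  length-cartesianProductWith f (x ∷ xs) ys =
    trans (length-++ (map (f x) ys))
      (cong₂ _+_ (length-map (f x) ys) (length-cartesianProductWith f xs ys))

  length-concatMap-≤ : ∀ {B : Set} (f : B → List A) {b} → (∀ x → length (f x) ≤ b) →
    ∀ xs → length (concatMap f xs) ≤ length xs * b
  length-concatMap-≤ f bound []       = z≤n
  length-concatMap-≤ f {b} bound (x ∷ xs) = begin
    length (f x ++ concatMap f xs)       ≡⟨ length-++ (f x) ⟩
    length (f x) + length (concatMap f xs) ≤⟨ +-mono-≤ (bound x) (length-concatMap-≤ f bound xs) ⟩
    b + length xs * b                    ∎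
    where open ≤-Reasoning

  module _ {P Q : A → Set} (P? : Decidable P) (Q? : Decidable Q) (P⊆Q : ∀ x → P x → Q x) where

    length-filter-mono-≤ : ∀ xs → length (filter P? xs) ≤ length (filter Q? xs)
    length-filter-mono-≤ [] = z≤n
    length-filter-mono-≤ (x ∷ xs) with P? x | Q? x
    ... | yes _ | yes _ = s≤s (length-filter-mono-≤ xs)
    ... | yes p | no ¬q = contradiction (P⊆Q x p) ¬q
    ... | no _  | yes _ = m≤n⇒m≤1+n (length-filter-mono-≤ xs)
    ... | no _  | no _  = length-filter-mono-≤ xs

    length-filter-mono-< : ∀ {x xs} → x ∈ xs → Q x → ¬ P x → length (filter P? xs) < length (filter Q? xs)
    length-filter-mono-< {x} {_ ∷ xs} (here refl) q ¬p with P? x | Q? x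
    ... | yes p | _     = contradiction p ¬p
    ... | no _  | no ¬q = contradiction q ¬q
    ... | no _  | yes _ = s≤s (length-filter-mono-≤ xs)
    length-filter-mono-< {x} {y ∷ xs} (there x∈) q ¬p with P? y | Q? y
    ... | yes _ | yes _ = s≤s (length-filter-mono-< x∈ q ¬p)
    ... | yes p | no ¬q = contradiction (P⊆Q y p) ¬q
    ... | no _  | yes _ = m≤n⇒m≤1+n (length-filter-mono-< x∈ q ¬p)
    ... | no _  | no _  = length-filter-mono-< x∈ q ¬p

module _ {n : ℕ} where

  size : {P : Fin n → Set} → Decidable P → ℕ
  size P? = length (filter P? (allFin n))

  size-mono-< : {P Q : Fin n → Set} (P? : Decidable P) (Q? : Decidable Q) →
    (∀ x → P x → Q x) → ∀ {x} → Q x → ¬ P x → size P? < size Q?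
  size-mono-< P? Q? P⊆Q {x} = length-filter-mono-< P? Q? P⊆Q (∈-allFin x)

  size<n : {P : Fin n → Set} (P? : Decidable P) → ∀ {x} → ¬ P x → size P? < n
  size<n P? {x} ¬p = begin-strict
    size P?                               <⟨ size-mono-< P? (λ _ → yes tt) (λ _ _ → tt) {x} tt ¬p ⟩
    size {P = λ _ → ⊤} (λ _ → yes tt)     ≤⟨ length-filter (λ _ → yes tt) (allFin n) ⟩
    length (allFin n)                     ≡⟨ length-tabulate id ⟩
    n                                     ∎
    where open ≤-Reasoning

  cardAtMost : {P : Fin n → Set} {k : ℕ} (ys : List (Fin n)) → (∀ x → P x → x ∈ ys) →
    length ys ≤ k → CardAtMost P k
  cardAtMost ys P⊆ys ≤k xs uniq all-P = ≤-trans (unique-length-≤ uniq (All.map (P⊆ys _) all-P)) ≤k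

-- Linear orders refining a time stamp

module SortBy {n : ℕ} (time : Fin n → ℕ) where

  -- The lexicographic code of time stamp and index: an index is below `n`, so ties within one time
  -- stamp are broken by index and the code is injective.
  key : Fin n → ℕ
  key x = time x * n + toℕ x

  time<⇒key< : ∀ x y → time x < time y → key x < key y
  time<⇒key< x y tx<ty = begin-strict
    time x * n + toℕ x <⟨ +-monoʳ-< (time x * n) (toℕ<n x) ⟩
    time x * n + n     ≡⟨ +-comm (time x * n) n ⟩
    suc (time x) * n   ≤⟨ *-monoˡ-≤ n tx<ty ⟩
    time y * n         ≤⟨ m≤m+n _ _ ⟩
    key y              ∎
    where open ≤-Reasoning

  key-injective : ∀ {x y} → key x ≡ key y → x ≡ y
  key-injective {x} {y} eq with <-cmp (time x) (time y)
  ... | tri< lt _ _ = contradiction eq (<⇒≢ (time<⇒key< x y lt))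
  ... | tri> _ _ gt = contradiction (sym eq) (<⇒≢ (time<⇒key< y x gt))
  ... | tri≈ _ tx≡ty _ = toℕ-injective (+-cancelˡ-≡ (time x * n) _ _
                          (trans eq (cong (λ s → s * n + toℕ y) (sym tx≡ty))))

  below? : ∀ x → Decidable (λ y → key y < key x)
  below? x y = key y <? key x

  position : Fin n → Fin n
  position x = fromℕ< (size<n (below? x) (<-irrefl refl))

  toℕ-position : ∀ x → toℕ (position x) ≡ size (below? x)
  toℕ-position x = toℕ-fromℕ< _

  key<⇒position< : ∀ x y → key x < key y → toℕ (position x) < toℕ (position y)
  key<⇒position< x y lt = subst₂ _<_ (sym (toℕ-position x)) (sym (toℕ-position y))
    (size-mono-< (below? x) (below? y) (λ z z<x → <-trans z<x lt) lt (<-irrefl refl))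

  ordering : Ordering n
  ordering = record
    { rank           = position
    ; rank-injective = λ {x} {y} → injective x y
    }
    where
    injective : ∀ x y → position x ≡ position y → x ≡ y
    injective x y eq with <-cmp (key x) (key y)
    ... | tri< lt _ _ = contradiction (cong toℕ eq) (<⇒≢ (key<⇒position< x y lt))
    ... | tri> _ _ gt = contradiction (cong toℕ (sym eq)) (<⇒≢ (key<⇒position< y x gt))
    ... | tri≈ _ eq′ _ = key-injective eq′

  -- All that the bounds learn about the ordering passes through this implication, so the order
  -- inside one time stamp is immaterial to them.
  ⪯⇒time≤ : ∀ {x y} → _⪯_ ordering x y → time x ≤ time y
  ⪯⇒time≤ {x} {y} x⪯y = ≮⇒≥ (λ lt → <⇒≱ (key<⇒position< y x (time<⇒key< y x lt)) x⪯y)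

-- Decompositions into pieces and the bounds they give

-- The decomposition is a forest of pieces. A node stores a level function and a list of strands
-- (each strand names one vertex per level), together with the way its piece was cut from the
-- component it lived in: that component sees only the pieces `parent` and `other`, and `other`
-- is always one of the two pieces seen by the component of `parent`, as in a 2-tree.
data Node (n m : ℕ) : Set where
  root : Node n m
  cut  : (level : Fin n → ℕ) (strands : List (ℕ → Fin n)) → length strands ≤ m →
         (fromParent : Bool) → Node n m → Node n m

module _ {n m : ℕ} where

  parent : Node n m → Node n m
  parent root          = root
  parent (cut _ _ _ _ i) = i

  other : Node n m → Node n m
  other root              = root
  other (cut _ _ _ true  i) = parent i
  other (cut _ _ _ false i) = other i

  Seen : Node n m → Node n m → Set
  Seen i j = j ≡ parent i ⊎ j ≡ other i

  other-seen : ∀ i → Seen (parent i) (other i)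
  other-seen root                = inj₁ refl
  other-seen (cut _ _ _ true  _) = inj₁ refl
  other-seen (cut _ _ _ false _) = inj₂ refl

  data Ancestor (i : Node n m) : ℕ → Node n m → Set where
    self : ∀ {k} → Ancestor i k i
    via  : ∀ {j k l} → Seen i j → Ancestor j k l → Ancestor i (suc k) l

  ancestor-mono : ∀ {i j k} → Ancestor i k j → Ancestor i (suc k) j
  ancestor-mono self      = self
  ancestor-mono (via s a) = via s (ancestor-mono a)

  parents : Node n m → ℕ → List (Node n m)
  parents i zero    = [ i ]
  parents i (suc k) = i ∷ parents (parent i) k

  -- Rows of lengths k + 1, k, ..., 1: the parent line of `i`, then that of `other i` with one step
  -- less, and so on. This triangle is the source of the binomial coefficient.
  ancestors : Node n m → ℕ → List (Node n m)
  ancestors i zero    = [ i ]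
  ancestors i (suc k) = parents i (suc k) ++ ancestors (other i) k

  -- An ancestor off the parent line is reached through `other i`: the parent line keeps seeing
  -- `other i` until it runs into it.
  ancestor-split : ∀ {i j} k → Ancestor i (suc k) j → j ∈ parents i (suc k) ⊎ Ancestor (other i) k j
  ancestor-split k self                  = inj₁ (here refl)
  ancestor-split k (via (inj₂ refl) a)   = inj₂ a
  ancestor-split zero (via (inj₁ refl) self) = inj₁ (there (here refl))
  ancestor-split {i} (suc k) (via (inj₁ refl) a) with ancestor-split k a
  ... | inj₁ j∈ = inj₁ (there j∈)
  ... | inj₂ b  with other-seen i
  ...   | inj₁ eq rewrite eq = inj₂ (via (other-seen (parent i)) b)
  ...   | inj₂ eq rewrite eq = inj₂ (ancestor-mono b)

  ancestor∈ : ∀ {i j} k → Ancestor i k j → j ∈ ancestors i k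
  ancestor∈ zero    self = here refl
  ancestor∈ {i} (suc k) a with ancestor-split k a
  ... | inj₁ j∈ = ∈-++⁺ˡ j∈
  ... | inj₂ b  = ∈-++⁺ʳ (parents i (suc k)) (ancestor∈ k b)

  length-parents : ∀ i k → length (parents i k) ≡ suc k
  length-parents i zero    = refl
  length-parents i (suc k) = cong suc (length-parents (parent i) k)

  length-ancestors : ∀ i k → length (ancestors i k) ≡ (k + 2) C 2
  length-ancestors i zero    = refl
  length-ancestors i (suc k) = begin
    length (parents i (suc k) ++ ancestors (other i) k)
      ≡⟨ length-++ (parents i (suc k)) ⟩
    length (parents i (suc k)) + length (ancestors (other i) k)
      ≡⟨ cong₂ _+_ (length-parents i (suc k)) (length-ancestors (other i) k) ⟩
    2 + k + (k + 2) C 2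
      ≡⟨ cong (_+ (k + 2) C 2) (trans (+-comm 2 k) (sym (nC1≡n (k + 2)))) ⟩
    (k + 2) C 1 + (k + 2) C 2
      ≡⟨ nCk+nC[k+1]≡[n+1]C[k+1] (k + 2) 1 ⟩
    suc (k + 2) C 2 ∎
    where open ≡-Reasoning

  -- Offset o stands for a level difference of o − r; truncation at level 0 only repeats entries.
  near : ℕ → Fin n → Node n m → List (Fin n)
  near r v root = []
  near r v (cut level strands _ _ _) =
    cartesianProductWith (λ z o → z (level v + o ∸ r)) strands (upTo (2 * r + 1))

  length-near : ∀ r v i → length (near r v i) ≤ m * (2 * r + 1)
  length-near r v root = z≤n
  length-near r v (cut level strands ≤m _ _) = begin
    length (cartesianProductWith (λ z o → z (level v + o ∸ r)) strands (upTo (2 * r + 1)))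
      ≡⟨ length-cartesianProductWith _ strands (upTo (2 * r + 1)) ⟩
    length strands * length (upTo (2 * r + 1))
      ≡⟨ cong (length strands *_) (length-upTo (2 * r + 1)) ⟩
    length strands * (2 * r + 1)
      ≤⟨ *-monoˡ-≤ (2 * r + 1) ≤m ⟩
    m * (2 * r + 1) ∎
    where open ≤-Reasoning

  module _ (G : Graph n) where

    -- `root` stands for an absent piece, so no vertex may carry it. The Lipschitz condition is
    -- asked on the whole zone, because the paths to be measured run outside the piece.
    Fits : Node n m → (Fin n → Set) → Fin n → Set
    Fits root Z v = ⊥
    Fits (cut level strands _ _ _) Z v =
      (∀ {x y} → Z x → Z y → Adj G x y → level y ≤ suc (level x)) ×
      (∃[ z ] z ∈ strands × z (level v) ≡ v)

    -- For v processed (not in D), zone is the component of v in the graph that remained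
    -- when the piece of v was chosen.
    record Certificate (D : Fin n → Set) (time : Fin n → ℕ) (node : Fin n → Node n m) (v : Fin n) : Set₁ where
      field
        zone   : Fin n → Set
        self∈  : zone v
        closed : ∀ {x y} → zone x → Adj G x y →
                 zone y ⊎ (¬ D y × time y < time v × Seen (node v) (node y))
        same   : ∀ {x} → zone x → ¬ D x → time x ≤ time v → node x ≡ node v
        fits   : Fits (node v) zone v

-- Paths against zones, and the two colouring bounds.

module Bounds {n m : ℕ} (G : Graph n) (time : Fin n → ℕ) (node : Fin n → Node n m)
  (certificate : ∀ v → Certificate G (λ _ → ⊥) time node v) where

  open SortBy time using (ordering; ⪯⇒time≤)
  module Cert v = Certificate (certificate v)
  open Cert

  Late : Fin n → Fin n → Set
  Late v w = time v ≤ time w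

  late-in-zone : ∀ v {x y} → zone v x → Adj G x y → Late v y → zone v y
  late-in-zone v zx xy late with closed v zx xy
  ... | inj₁ zy           = zy
  ... | inj₂ (_ , lt , _) = contradiction late (<⇒≱ lt)

  -- As long as the path stays in the zone of `v` nothing changes. When it leaves to `u`, the node
  -- of `u` is seen by that of `v`, and `u` takes over the role of `v`; each exit costs one edge.
  -- The end `x` is earliest, so if it lies in the current zone, `same` identifies its node.
  path-ancestor : ∀ v {w x} mid → zone v w → Late x v → All (Late x) mid →
    Linked (Adj G) (w ∷ mid ++ [ x ]) → Ancestor (node v) (suc (length mid)) (node x)
  path-ancestor v [] zw xv [] (wx ∷ [-]) with closed v zw wx
  ... | inj₁ zx          = subst (Ancestor (node v) 1) (sym (same v zx id xv)) self
  ... | inj₂ (_ , _ , s) = via s self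
  path-ancestor v (u ∷ mid) zw xv (xu ∷ late) (wu ∷ path) with closed v zw wu
  ... | inj₁ zu          = ancestor-mono (path-ancestor v mid zu xv late path)
  ... | inj₂ (_ , _ , s) = via s (path-ancestor u mid (self∈ u) xu late path)

  -- Leaving the zone of `v` means meeting a strictly earlier vertex, which only the last edge can
  -- do.
  path-seen : ∀ v {w x} mid → zone v w → Late x v → All (Late v) mid →
    Linked (Adj G) (w ∷ mid ++ [ x ]) → node x ≡ node v ⊎ Seen (node v) (node x)
  path-seen v [] zw xv [] (wx ∷ [-]) with closed v zw wx
  ... | inj₁ zx          = inj₁ (same v zx id xv)
  ... | inj₂ (_ , _ , s) = inj₂ s
  path-seen v (u ∷ mid) zw xv (vu ∷ late) (wu ∷ path) =
    path-seen v mid (late-in-zone v zw wu vu) xv late path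

  -- The relevant zone is that of `x`, not of `v`: seen backwards from `x`, the path meets only
  -- vertices no earlier than `x` and cannot leave this zone, where the level changes by at most one
  -- per edge.
  path-level : ∀ {level : Fin n → ℕ} {v x} mid →
    (∀ {y z} → zone x y → zone x z → Adj G y z → level z ≤ suc (level y)) →
    Late x v → All (Late x) mid → Linked (Adj G) (v ∷ mid ++ [ x ]) →
    zone x v × level v ≤ level x + suc (length mid) × level x ≤ level v + suc (length mid)
  path-level {level} {v} {x} [] lip xv [] (vx ∷ [-]) =
    zv , subst (level v ≤_) (+-comm 1 (level x)) (lip (self∈ x) zv xv′) ,
         subst (level x ≤_) (+-comm 1 (level v)) (lip zv (self∈ x) vx)
    where
    xv′ = subst T (Graph.sym G v x) vx
    zv  = late-in-zone x (self∈ x) xv′ xv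
  path-level {level} {v} {x} (u ∷ mid) lip xv (xu ∷ late) (vu ∷ path)
    with path-level {level} mid lip xu late path
  ... | zu , u≤ , ≤u = zv , v≤ , ≤v
    where
    open ≤-Reasoning
    k   = suc (length mid)
    uv  = subst T (Graph.sym G v u) vu
    zv  = late-in-zone x zu uv xv
    v≤ : level v ≤ level x + suc k
    v≤ = begin
      level v             ≤⟨ lip zu zv uv ⟩
      suc (level u)       ≤⟨ s≤s u≤ ⟩
      suc (level x + k)   ≡⟨ +-suc (level x) k ⟨
      level x + suc k     ∎
    ≤v : level x ≤ level v + suc k
    ≤v = begin
      level x             ≤⟨ ≤u ⟩
      level u + k         ≤⟨ +-monoˡ-≤ k (lip zv zu vu) ⟩
      suc (level v + k)   ≡⟨ +-suc (level v) k ⟨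
      level v + suc k     ∎

  -- With `a` the level of `v` and `b` that of the target, `b + r ∸ a` is the index to look up in
  -- `near`; the first hypothesis makes this truncated subtraction exact.
  offset : ∀ {a b} r → a ≤ b + r → b ≤ a + r → b + r ∸ a < 2 * r + 1 × a + (b + r ∸ a) ∸ r ≡ b
  offset {a} {b} r a≤ b≤ = lt , eq
    where
    lt : b + r ∸ a < 2 * r + 1
    lt = subst (b + r ∸ a <_) (+-comm 1 (2 * r)) (s≤s (m≤n+o⇒m∸n≤o _ a (begin
      b + r         ≤⟨ +-monoˡ-≤ r b≤ ⟩
      a + r + r     ≡⟨ +-assoc a r r ⟩
      a + (r + r)   ≡⟨ cong (λ s → a + (r + s)) (+-identityʳ r) ⟨
      a + 2 * r     ∎)))
      where open ≤-Reasoning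
    eq : a + (b + r ∸ a) ∸ r ≡ b
    eq = trans (cong (_∸ r) (m+[n∸m]≡n a≤)) (m+n∸n≡m b r)

  -- The closeness is demanded for every Lipschitz level function, because the one stored in `i`
  -- appears only after matching on `i`.
  level∈near : ∀ r {v x} (i : Node n m) {Z : Fin n → Set} → Fits G i Z x →
    (∀ {level : Fin n → ℕ} → (∀ {y z} → Z y → Z z → Adj G y z → level z ≤ suc (level y)) →
      level v ≤ level x + r × level x ≤ level v + r) → x ∈ near r v i
  level∈near r {v} (cut level strands _ _ _) (lip , z , z∈ , zx≡x) close
    with close {level} lip
  ... | v≤ , x≤ with offset r v≤ x≤
  ...   | o< , eq = subst (_∈ _) (trans (cong z eq) zx≡x)
                      (∈-cartesianProductWith⁺ _ z∈ (∈-upTo⁺ o<))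

  self∈near : ∀ r v → v ∈ near r v (node v)
  self∈near r v = level∈near r (node v) (fits v) (λ {level} _ → m≤m+n (level v) r , m≤m+n (level v) r)

  path∈near : ∀ r {v x} mid → suc (length mid) ≤ r → Late x v → All (Late x) mid →
    Linked (Adj G) (v ∷ mid ++ [ x ]) → x ∈ near r v (node x)
  path∈near r {v} {x} mid ≤r xv late path = level∈near r (node x) (fits x) (λ {level} → close {level})
    where
    close : ∀ {level : Fin n → ℕ} → (∀ {y z} → zone x y → zone x z → Adj G y z → level z ≤ suc (level y)) →
      level v ≤ level x + r × level x ≤ level v + r
    close {level} lip with path-level {level} mid lip xv late path
    ... | _ , v≤ , x≤ = ≤-trans v≤ (+-monoʳ-≤ (level x) ≤r) , ≤-trans x≤ (+-monoʳ-≤ (level v) ≤r)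

  ancestor-weaken : ∀ {i j : Node n m} {k l} → k ≤ l → Ancestor i k j → Ancestor i l j
  ancestor-weaken _         self      = self
  ancestor-weaken (s≤s k≤l) (via s a) = via s (ancestor-weaken k≤l a)

  wcol-bound : ∀ r → wcol≤ G r (((r + 2) C 2) * (m * (2 * r + 1)))
  wcol-bound r = ordering , λ v →
    cardAtMost (concatMap (near r v) (ancestors (node v) r)) (λ x → covered v x)
      (≤-trans (length-concatMap-≤ (near r v) (length-near r v) (ancestors (node v) r))
        (≤-reflexive (cong (_* (m * (2 * r + 1))) (length-ancestors (node v) r))))
    where
    listed : ∀ v x → Ancestor (node v) r (node x) → x ∈ near r v (node x) →
      x ∈ concatMap (near r v) (ancestors (node v) r)
    listed v x a x∈ = ∈-concatMap⁺ (near r v) (Any.map (λ eq → subst (λ i → x ∈ near r v i) eq x∈) (ancestor∈ r a))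
    covered : ∀ v x → WReach G ordering r v x → x ∈ concatMap (near r v) (ancestors (node v) r)
    covered v .v (_ , inj₁ refl) = listed v v self (self∈near r v)
    covered v x (x⪯v , inj₂ (mid , ≤r , path , _ , x≺mid)) =
      listed v x (ancestor-weaken ≤r (path-ancestor v mid (self∈ v) xv late path))
        (path∈near r mid ≤r xv late path)
      where
      xv   = ⪯⇒time≤ x⪯v
      late = All.map (⪯⇒time≤ ∘ <⇒≤) x≺mid

  scol-bound : ∀ r → scol≤ G r (3 * (m * (2 * r + 1)))
  scol-bound r = ordering , λ v →
    cardAtMost (concatMap (near r v) (visible v)) (λ x → covered v x)
      (length-concatMap-≤ (near r v) (length-near r v) (visible v))
    where
    visible : ∀ v → List (Node n m)
    visible v = node v ∷ parent (node v) ∷ other (node v) ∷ []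
    listed : ∀ v x → node x ∈ visible v → x ∈ near r v (node x) → x ∈ concatMap (near r v) (visible v)
    listed v x i∈ x∈ = ∈-concatMap⁺ (near r v) (Any.map (λ eq → subst (λ i → x ∈ near r v i) eq x∈) i∈)
    visible⁺ : ∀ v x → node x ≡ node v ⊎ Seen (node v) (node x) → node x ∈ visible v
    visible⁺ v x (inj₁ eq)        = here eq
    visible⁺ v x (inj₂ (inj₁ eq)) = there (here eq)
    visible⁺ v x (inj₂ (inj₂ eq)) = there (there (here eq))
    covered : ∀ v x → SReach G ordering r v x → x ∈ concatMap (near r v) (visible v)
    covered v .v (_ , inj₁ refl) = listed v v (here refl) (self∈near r v)
    covered v x (x⪯v , inj₂ (mid , ≤r , path , _ , v≺mid)) =
      listed v x (visible⁺ v x (path-seen v mid (self∈ v) xv late path))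
        (path∈near r mid ≤r xv (All.map (≤-trans xv) late) path)
      where
      xv   = ⪯⇒time≤ x⪯v
      late = All.map (⪯⇒time≤ ∘ <⇒≤) v≺mid

-- Reachability and breadth-first trees

module _ {n : ℕ} (G : Graph n) where

  adj? : ∀ u v → Dec (Adj G u v)
  adj? u v = T? (Graph.adj G u v)

  adj-sym : ∀ {u v} → Adj G u v → Adj G v u
  adj-sym {u} {v} = subst T (Graph.sym G u v)

  -- Unlike in `ConnectedWithin`, both ends satisfy `P`. The length index is what breadth-first
  -- distance is read off from.
  data Walk (P : Fin n → Set) (x : Fin n) : ℕ → Fin n → Set where
    nil  : P x → Walk P x 0 x
    snoc : ∀ {k y z} → Walk P x k y → Adj G y z → P z → Walk P x (suc k) z

  Reach : (Fin n → Set) → Fin n → Fin n → Set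
  Reach P x y = ∃[ k ] Walk P x k y

  Connected : (Fin n → Set) → Set
  Connected P = ∀ {x y} → P x → P y → Reach P x y

  Touches : (Fin n → Set) → Fin n → Set
  Touches Y x = ∃[ y ] Y y × Adj G x y

  Adjacent : (Fin n → Set) → (Fin n → Set) → Set
  Adjacent X Y = ∃[ x ] X x × Touches Y x

  touches? : ∀ {Y} → Decidable Y → Decidable (Touches Y)
  touches? Y? x = any? (λ y → Y? y ×-dec adj? x y)

  adjacent? : ∀ {X Y} → Decidable X → Decidable Y → Dec (Adjacent X Y)
  adjacent? X? Y? = any? (λ x → X? x ×-dec touches? Y? x)

  adjacent-sym : ∀ {X Y} → Adjacent X Y → Adjacent Y X
  adjacent-sym (x , Xx , y , Yy , xy) = y , Yy , x , Xx , adj-sym xy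

  adjacent-mono : ∀ {X X′ Y Y′} → (∀ {x} → X x → X′ x) → (∀ {y} → Y y → Y′ y) →
    Adjacent X Y → Adjacent X′ Y′
  adjacent-mono X⊆ Y⊆ (x , Xx , y , Yy , xy) = x , X⊆ Xx , y , Y⊆ Yy , xy

  walk? : ∀ {P} → Decidable P → ∀ x k → Decidable (Walk P x k)
  walk? P? x zero z with x ≟ᶠ z | P? x
  ... | yes refl | yes p = yes (nil p)
  ... | yes refl | no ¬p = no λ { (nil p) → ¬p p }
  ... | no x≢z   | _     = no λ { (nil _) → x≢z refl }
  walk? P? x (suc k) z with any? (λ y → walk? P? x k y ×-dec adj? y z ×-dec P? z)
  ... | yes (y , w , yz , p) = yes (snoc w yz p)
  ... | no ¬w                = no λ { (snoc w yz p) → ¬w (_ , w , yz , p) }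

  module _ {P : Fin n → Set} where

    walk-end : ∀ {x k y} → Walk P x k y → P y
    walk-end (nil p)      = p
    walk-end (snoc _ _ p) = p

    walk-start : ∀ {x k y} → Walk P x k y → P x
    walk-start (nil p)      = p
    walk-start (snoc w _ _) = walk-start w

    reach-end : ∀ {x y} → Reach P x y → P y
    reach-end (_ , w) = walk-end w

    reach-start : ∀ {x y} → Reach P x y → P x
    reach-start (_ , w) = walk-start w

    reach-refl : ∀ {x} → P x → Reach P x x
    reach-refl p = 0 , nil p

    reach-snoc : ∀ {x y z} → Reach P x y → Adj G y z → P z → Reach P x z
    reach-snoc (k , w) yz p = suc k , snoc w yz p

    reach-trans : ∀ {x y z} → Reach P x y → Reach P y z → Reach P x z
    reach-trans xy (_ , nil _)       = xy
    reach-trans xy (_ , snoc w yz p) = reach-snoc (reach-trans xy (_ , w)) yz p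

    reach-sym : ∀ {x y} → Reach P x y → Reach P y x
    reach-sym (_ , nil p)       = reach-refl p
    reach-sym (_ , snoc w yz p) =
      reach-trans (reach-snoc (reach-refl p) (adj-sym yz) (walk-end w)) (reach-sym (_ , w))

    -- The walk is taken in reverse, so that its last edge becomes the head of the list.
    connected-within : ∀ {x y} → Reach P y x → ConnectedWithin G P x y
    connected-within (_ , nil _) = inj₁ refl
    connected-within (_ , snoc {y = z} w zx p) with connected-within (_ , w)
    ... | inj₁ refl               = inj₂ ([] , adj-sym zx ∷ [-] , [])
    ... | inj₂ (mid , path , all) = inj₂ (z ∷ mid , adj-sym zx ∷ path , walk-end w ∷ all)

  reach-mono : ∀ {P Q : Fin n → Set} → (∀ {x} → P x → Q x) → ∀ {x y} → Reach P x y → Reach Q x y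
  reach-mono P⊆Q (_ , nil p)       = reach-refl (P⊆Q p)
  reach-mono P⊆Q (_ , snoc w yz p) = reach-snoc (reach-mono P⊆Q (_ , w)) yz (P⊆Q p)

  reach-within : ∀ {P x y} → Reach P x y → Reach (Reach P x) x y
  reach-within (_ , nil p)       = reach-refl (reach-refl p)
  reach-within (_ , snoc w yz p) = reach-snoc (reach-within (_ , w)) yz (_ , snoc w yz p)

  component-connected : ∀ {P} x → Connected (Reach P x)
  component-connected x xy xz = reach-trans (reach-sym (reach-within xy)) (reach-within xz)

  module _ {P : Fin n → Set} (P? : Decidable P) (x : Fin n) where

    -- A decidable set of reached vertices grows by one neighbour at a time while its complement
    -- shrinks. Once no neighbour in `P` is missing, induction along walks shows that it contains
    -- everything reachable.
    saturate : ∀ {S} (S? : Decidable S) → (∀ {y} → S y → Reach P x y) → S x →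
      Acc _<_ (size (λ y → ¬? (S? y))) → Decidable (Reach P x)
    saturate {S} S? sound start (acc rec)
      with any? (λ z → P? z ×-dec ¬? (S? z) ×-dec any? (λ y → S? y ×-dec adj? y z))
    ... | yes (z , p , ¬s , y , s , yz) =
      saturate S∪z? sound′ (inj₁ start)
        (rec (size-mono-< (λ v → ¬? (S∪z? v)) (λ v → ¬? (S? v)) (λ v ¬sv sv → ¬sv (inj₁ sv)) ¬s (λ ¬z → ¬z (inj₂ refl))))
      where
      S∪z? : Decidable (λ v → S v ⊎ v ≡ z)
      S∪z? v = S? v ⊎-dec v ≟ᶠ z
      sound′ : ∀ {v} → S v ⊎ v ≡ z → Reach P x v
      sound′ (inj₁ sv)   = sound sv
      sound′ (inj₂ refl) = reach-snoc (sound s) yz p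
    ... | no closed = decide
      where
      complete : ∀ {k v} → Walk P x k v → S v
      complete (nil _) = start
      complete (snoc {z = v} w yv p) with S? v
      ... | yes s = s
      ... | no ¬s = contradiction (v , p , ¬s , _ , complete w , yv) closed
      decide : Decidable (Reach P x)
      decide v with S? v
      ... | yes s = yes (sound s)
      ... | no ¬s = no (¬s ∘ complete ∘ proj₂)

    abstract
      reach? : Decidable (Reach P x)
      reach? with P? x
      ... | yes p = saturate (_≟ᶠ x) (λ { refl → reach-refl p }) refl (<-wellFounded _)
      ... | no ¬p = λ v → no (¬p ∘ reach-start)

  connected-extend : ∀ {P Q} → Connected Q → (∀ {x} → Q x → P x) →
    (∀ {x} → P x → ∃[ q ] Q q × Reach P x q) → Connected P
  connected-extend conn Q⊆P to-Q px py with to-Q px | to-Q py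
  ... | q , Qq , xq | q′ , Qq′ , yq′ =
    reach-trans xq (reach-trans (reach-mono Q⊆P (conn Qq Qq′)) (reach-sym yq′))

  connected-join : ∀ {P Q} → Connected P → Connected Q → Adjacent P Q → Connected (λ x → P x ⊎ Q x)
  connected-join {P} {Q} connP connQ (p , Pp , q , Qq , pq) = connected-extend connP inj₁ λ
    { (inj₁ Px) → _ , Px , reach-refl (inj₁ Px)
    ; (inj₂ Qx) → p , Pp , reach-snoc (reach-mono inj₂ (connQ Qx Qq)) (adj-sym pq) (inj₁ Pp)
    }

  singleton-connected : ∀ v → Connected (_≡ v)
  singleton-connected v refl refl = reach-refl refl

  least : ∀ {P : ℕ → Set} → Decidable P → ∀ k → P k → ∃[ l ] P l × (∀ {j} → P j → l ≤ j)
  least P? zero p = zero , p , λ _ → z≤n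
  least P? (suc k) p with P? zero
  ... | yes p₀ = zero , p₀ , λ _ → z≤n
  ... | no ¬p₀ with least (P? ∘ suc) k p
  ...   | l , pl , min = suc l , pl , λ { {zero} p₀ → contradiction p₀ ¬p₀ ; {suc j} pj → s≤s (min pj) }

  module BFS {K : Fin n → Set} (K? : Decidable K) (connected : Connected K) {ρ : Fin n} (ρ∈K : K ρ) where

    abstract
      distance : ∀ x → ∃[ k ] (K x → Walk K ρ k x × (∀ {j} → Walk K ρ j x → k ≤ j))
      distance x with K? x
      -- An arbitrary value outside `K`, where the specification is vacuous; it makes `level` total.
      ... | no ¬c = 0 , λ c → contradiction c ¬c
      ... | yes c with connected ρ∈K c
      ...   | j , w with least (λ k → walk? K? ρ k x) j w
      ...     | k , spec = k , λ _ → spec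

    level : Fin n → ℕ
    level x = proj₁ (distance x)

    level-walk : ∀ {x} → K x → Walk K ρ (level x) x
    level-walk {x} c = proj₁ (proj₂ (distance x) c)

    level-min : ∀ {x k} → Walk K ρ k x → level x ≤ k
    level-min {x} w = proj₂ (proj₂ (distance x) (walk-end w)) w

    level-lipschitz : ∀ {x y} → K x → K y → Adj G x y → level y ≤ suc (level x)
    level-lipschitz cx cy xy = level-min (snoc (level-walk cx) xy cy)

    abstract
      predecessor : ∀ x → ∃[ p ] (K x → x ≢ ρ → K p × Adj G p x × level x ≡ suc (level p))
      predecessor x = by-membership (K? x)
        where
        last : ∀ {k} → K x → Walk K ρ k x → level x ≡ k →
          ∃[ p ] (K x → x ≢ ρ → K p × Adj G p x × level x ≡ suc (level p))
        last c (nil _) _ = x , λ _ x≢ρ → contradiction refl x≢ρ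
        last c (snoc {y = p} w px _) eq = p , λ _ _ → walk-end w , px ,
          -- The walk is shortest: its initial part bounds the level of `p` from above, and the
          -- Lipschitz property gives the other inequality.
          ≤-antisym (level-lipschitz (walk-end w) c px) (≤-trans (s≤s (level-min w)) (≤-reflexive (sym eq)))
        by-membership : Dec (K x) → ∃[ p ] (K x → x ≢ ρ → K p × Adj G p x × level x ≡ suc (level p))
        by-membership (no ¬c) = x , λ c → contradiction c ¬c
        by-membership (yes c) = last c (level-walk c) refl

    up : Fin n → Fin n
    up x = proj₁ (predecessor x)

    up∈K : ∀ {x} → K x → x ≢ ρ → K (up x)
    up∈K {x} c x≢ρ = proj₁ (proj₂ (predecessor x) c x≢ρ)

    up-adj : ∀ {x} → K x → x ≢ ρ → Adj G x (up x)
    up-adj {x} c x≢ρ = adj-sym (proj₁ (proj₂ (proj₂ (predecessor x) c x≢ρ)))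

    level-up : ∀ {x} → K x → x ≢ ρ → level x ≡ suc (level (up x))
    level-up {x} c x≢ρ = proj₂ (proj₂ (proj₂ (predecessor x) c x≢ρ))

    record Subtree (X : Fin n → Set) : Set where
      field
        inside    : ∀ {x} → X x → K x
        rooted    : X ρ
        up-closed : ∀ {x} → X x → x ≢ ρ → X (up x)

    open Subtree

    Child : (Fin n → Set) → Fin n → Fin n → Set
    Child X x y = X y × y ≢ ρ × up y ≡ x

    -- The root is excluded even if it is the only vertex, so every leaf has a tree edge upwards.
    Leaf : (Fin n → Set) → Fin n → Set
    Leaf X x = X x × x ≢ ρ × ¬ ∃ (Child X x)

    child? : ∀ {X} → Decidable X → ∀ x → Decidable (Child X x)
    child? X? x y = X? y ×-dec ¬? (y ≟ᶠ ρ) ×-dec up y ≟ᶠ x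

    leaf? : ∀ {X} → Decidable X → Decidable (Leaf X)
    leaf? X? x = X? x ×-dec ¬? (x ≟ᶠ ρ) ×-dec ¬? (any? (child? X? x))

    -- Each `up` lowers the level by one, so the climb stops at the root. Membership of the root in
    -- `Q` is a result and not an assumption, which suits sets such as the hub.
    climb-within : ∀ {X Q} → Subtree X → (∀ {x} → Q x → X x) →
      (∀ {x} → Q x → x ≢ ρ → Q (up x)) → ∀ {x} → Q x → Q ρ × Reach Q x ρ
    climb-within {X} {Q} tree Q⊆X up-Q {x} q = go (level x) q refl
      where
      go : ∀ k {x} → Q x → level x ≡ k → Q ρ × Reach Q x ρ
      go k {x} q eq with x ≟ᶠ ρ
      ... | yes refl = q , reach-refl q
      go zero q eq | no x≢ρ = contradiction (trans (sym eq) (level-up (inside tree (Q⊆X q)) x≢ρ)) λ ()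
      go (suc k) {x} q eq | no x≢ρ
        with go k (up-Q q x≢ρ) (suc-injective (trans (sym (level-up (inside tree (Q⊆X q)) x≢ρ)) eq))
      ... | qρ , r = qρ , reach-trans (reach-snoc (reach-refl q) (up-adj (inside tree (Q⊆X q)) x≢ρ) (up-Q q x≢ρ)) r

    connected-to-root : ∀ {X Q} → Subtree X → (∀ {x} → Q x → X x) →
      (∀ {x} → Q x → x ≢ ρ → Q (up x)) → Connected Q
    connected-to-root tree Q⊆X up-Q qx qy =
      reach-trans (proj₂ (climb-within tree Q⊆X up-Q qx)) (reach-sym (proj₂ (climb-within tree Q⊆X up-Q qy)))

    climb : ℕ → Fin n → Fin n
    climb zero    x = x
    climb (suc k) x = up (climb k x)

    -- The tree ancestor of a vertex of `K` at level `k`; beyond its own level, truncation returns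
    -- the vertex itself.
    branch-to : Fin n → ℕ → Fin n
    branch-to x k = climb (level x ∸ k) x

    -- Descend to children until none is left; fewer vertices of `X` are deeper after each step. The
    -- number `k` of steps is recovered as the difference of the levels.
    leaf-below : ∀ {X} (X? : Decidable X) → Subtree X → ∀ {x} → X x → x ≢ ρ →
      ∃[ y ] Leaf X y × branch-to y (level x) ≡ x
    leaf-below {X} X? tree {x} Xx x≢ρ with go x Xx x≢ρ (<-wellFounded _)
      where
      deeper? : ∀ x → Decidable (λ y → X y × level x < level y)
      deeper? x y = X? y ×-dec level x <? level y
      go : ∀ x → X x → x ≢ ρ → Acc _<_ (size (deeper? x)) →
        ∃[ y ] Leaf X y × (∃[ k ] level y ≡ k + level x × climb k y ≡ x)
      go x Xx x≢ρ (acc rec) with any? (child? X? x)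
      ... | no leaf = x , (Xx , x≢ρ , leaf) , 0 , refl , refl
      ... | yes (c , Xc , c≢ρ , refl) with level-up (inside tree Xc) c≢ρ
      ...   | eq with go c Xc c≢ρ (rec (size-mono-< (deeper? c) (deeper? x)
                        (λ y (Xy , lt) → Xy , <-trans (≤-reflexive (sym eq)) lt)
                        (Xc , ≤-reflexive (sym eq)) (<-irrefl refl ∘ proj₂)))
      ...     | y , leaf , k , lev , refl = y , leaf , suc k ,
                trans lev (trans (cong (k +_) eq) (+-suc k _)) , refl
    ... | y , leaf , k , lev , eq = y , leaf ,
      trans (cong (λ j → climb j y) (trans (cong (_∸ level x) lev) (m+n∸n≡m k (level x)))) eq

    -- Separating subtrees and the minor

    Outside : (Fin n → Set) → Fin n → Set
    Outside X x = K x × ¬ X x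

    outside? : ∀ {X} → Decidable X → Decidable (Outside X)
    outside? X? x = K? x ×-dec ¬? (X? x)

    -- The union of the components of K - X that see `Y`.
    Fringe : (Fin n → Set) → (Fin n → Set) → Fin n → Set
    Fringe X Y x = ∃[ a ] Touches Y a × Reach (Outside X) a x

    Grow : (Fin n → Set) → (Fin n → Set) → Fin n → Set
    Grow X Y x = Y x ⊎ Fringe X Y x

    -- Some single component of K - X sees both `Y₁` and `Y₂`.
    Bridged : (Fin n → Set) → (Fin n → Set) → (Fin n → Set) → Set
    Bridged X Y₁ Y₂ = ∃[ b ] Fringe X Y₁ b × Touches Y₂ b

    fringe? : ∀ {X Y} → Decidable X → Decidable Y → Decidable (Fringe X Y)
    fringe? X? Y? x = any? (λ a → touches? Y? a ×-dec reach? (outside? X?) a x)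

    grow? : ∀ {X Y} → Decidable X → Decidable Y → Decidable (Grow X Y)
    grow? X? Y? x = Y? x ⊎-dec fringe? X? Y? x

    bridged? : ∀ {X Y₁ Y₂} → Decidable X → Decidable Y₁ → Decidable Y₂ → Dec (Bridged X Y₁ Y₂)
    bridged? X? Y₁? Y₂? = any? (λ b → fringe? X? Y₁? b ×-dec touches? Y₂? b)

    bridged-sym : ∀ {X Y₁ Y₂} → Bridged X Y₁ Y₂ → Bridged X Y₂ Y₁
    bridged-sym (b , (a , touch-a , r) , touch-b) = a , (b , touch-b , reach-sym r) , touch-a

    fringe⊆K : ∀ {X Y x} → Fringe X Y x → K x
    fringe⊆K (_ , _ , r) = proj₁ (reach-end r)

    fringe∉X : ∀ {X Y x} → Fringe X Y x → ¬ X x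
    fringe∉X (_ , _ , r) = proj₂ (reach-end r)

    grow-connected : ∀ {X Y} → Connected Y → Connected (Grow X Y)
    grow-connected conn = connected-extend conn inj₁ λ
      { (inj₁ y) → _ , y , reach-refl (inj₁ y)
      ; (inj₂ (a , (y , Yy , ay) , r)) → y , Yy ,
          reach-snoc (reach-sym (reach-mono (λ r′ → inj₂ (a , (y , Yy , ay) , r′)) (reach-within r))) ay (inj₁ Yy)
      }

    -- Follow the walk from its start next to `Y`. Before it meets `S` it stays in the fringe; the
    -- first vertex in `S` is preceded by a fringe vertex, or is itself a neighbour of `Y`.
    sweep : ∀ {X Y P S : Fin n → Set} → (∀ {x} → P x → Outside X x ⊎ S x) →
      ∀ {a k x} → Touches Y a → Walk P a k x → Fringe X Y x ⊎ Adjacent S (Grow X Y)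
    sweep split {a} touch (nil p) with split p
    ... | inj₁ out = inj₁ (a , touch , reach-refl out)
    ... | inj₂ s   with touch
    ...   | y , Yy , ay = inj₂ (a , s , y , inj₁ Yy , ay)
    sweep split touch (snoc {y = x} {z} w xz p) with sweep split touch w
    ... | inj₂ adjacent = inj₂ adjacent
    ... | inj₁ fx@(b , touch-b , r) with split p
    ...   | inj₁ out = inj₁ (b , touch-b , reach-snoc r xz out)
    ...   | inj₂ s   = inj₂ (z , s , x , inj₂ fx , adj-sym xz)

    grow-adjacent : ∀ {X Y} → Decidable X → Subtree X → Adjacent K Y → Adjacent X (Grow X Y)
    grow-adjacent {X} X? tree (a , Ka , touch)
      with sweep split touch (proj₂ (connected Ka ρ∈K))
      where
      split : ∀ {x} → K x → Outside X x ⊎ X x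
      split {x} Kx with X? x
      ... | yes Xx = inj₂ Xx
      ... | no ¬Xx = inj₁ (Kx , ¬Xx)
    -- The walk ends at the root, which lies in `X`, so it cannot have stayed in the fringe.
    ... | inj₁ fringe   = contradiction (rooted tree) (fringe∉X fringe)
    ... | inj₂ adjacent = adjacent

    Without : (Fin n → Set) → Fin n → Fin n → Set
    Without X l x = X x × x ≢ l

    Critical : (Fin n → Set) → (Fin n → Set) → (Fin n → Set) → Set
    Critical X Y₁ Y₂ = ∀ {l} → Leaf X l → Bridged (Without X l) Y₁ Y₂

    -- A bridge that appears only when `l` is freed must pass through `l`; sweeping along it from
    -- the `Y₁` end, the first arrival at `l` gives the adjacency.
    critical-leaf-touches : ∀ {X Y₁ Y₂ l} → Decidable X → ¬ Bridged X Y₁ Y₂ →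
      Bridged (Without X l) Y₁ Y₂ → Touches (Grow X Y₁) l
    critical-leaf-touches {X} {l = l} X? ¬bridged (b , (a , touch-a , _ , w) , touch-b)
      with sweep split touch-a w
      where
      split : ∀ {x} → Outside (Without X l) x → Outside X x ⊎ x ≡ l
      split {x} (Kx , ¬X∖l) with x ≟ᶠ l
      ... | yes x≡l = inj₂ x≡l
      ... | no x≢l  = inj₁ (Kx , λ Xx → ¬X∖l (Xx , x≢l))
    ... | inj₁ fringe               = contradiction (b , fringe , touch-b) ¬bridged
    ... | inj₂ (_ , refl , touch-l) = touch-l

    record Separator (Y₁ Y₂ : Fin n → Set) : Set₁ where
      field
        X         : Fin n → Set
        X?        : Decidable X
        tree      : Subtree X
        separates : ¬ Bridged X Y₁ Y₂
        critical  : Critical X Y₁ Y₂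

    module _ {Y₁ Y₂ : Fin n → Set} (Y₁? : Decidable Y₁) (Y₂? : Decidable Y₂) where

      -- Leaves are deleted greedily as long as the tree still separates; a childless vertex can go
      -- without harming closure under `up`. When no leaf can be deleted, the tree is critical.
      prune : ∀ {X} (X? : Decidable X) → Subtree X → ¬ Bridged X Y₁ Y₂ →
        Acc _<_ (size X?) → Separator Y₁ Y₂
      prune {X} X? tree sep (acc rec)
        with any? (λ l → leaf? X? l ×-dec ¬? (bridged? (λ x → X? x ×-dec ¬? (x ≟ᶠ l)) Y₁? Y₂?))
      ... | yes (l , (Xl , l≢ρ , childless) , sep′) =
        prune X∖l? tree∖l sep′ (rec (size-mono-< X∖l? X? (λ _ → proj₁) Xl (λ X∖l → proj₂ X∖l refl)))
        where
        X∖l? : Decidable (Without X l)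
        X∖l? x = X? x ×-dec ¬? (x ≟ᶠ l)
        tree∖l : Subtree (Without X l)
        tree∖l = record
          { inside    = inside tree ∘ proj₁
          ; rooted    = rooted tree , (λ ρ≡l → l≢ρ (sym ρ≡l))
          ; up-closed = λ {x} (Xx , _) x≢ρ → up-closed tree Xx x≢ρ , λ up≡l → childless (x , Xx , x≢ρ , up≡l)
          }
      ... | no ¬removable = record
        { X = X ; X? = X? ; tree = tree ; separates = sep
        ; critical = λ {l} leaf → decidable-stable (bridged? (λ x → X? x ×-dec ¬? (x ≟ᶠ l)) Y₁? Y₂?)
                       (λ sep′ → ¬removable (l , leaf , sep′))
        }

      abstract
        separator : Separator Y₁ Y₂
        -- Pruning starts from all of `K`, which separates because nothing of `K` is left outside.
        separator = prune K? whole (λ { (_ , (_ , _ , r) , _) → proj₂ (reach-end r) (proj₁ (reach-end r)) }) (<-wellFounded _)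
          where
          whole : Subtree K
          whole = record { inside = id ; rooted = ρ∈K ; up-closed = up∈K }

    module _ {Y₁ Y₂ : Fin n → Set} (sep : Separator Y₁ Y₂) where

      open Separator sep

      leaf-touches₁ : ∀ {l} → Leaf X l → Touches (Grow X Y₁) l
      leaf-touches₁ leaf = critical-leaf-touches X? separates (critical leaf)

      leaf-touches₂ : ∀ {l} → Leaf X l → Touches (Grow X Y₂) l
      leaf-touches₂ leaf = critical-leaf-touches X? (separates ∘ bridged-sym) (bridged-sym (critical leaf))

      module Minor
        (connected₁ : Connected Y₁) (connected₂ : Connected Y₂)
        (avoids₁ : ∀ {x} → Y₁ x → ¬ K x) (avoids₂ : ∀ {x} → Y₂ x → ¬ K x)
        (apart : ∀ {x} → Y₁ x → ¬ Y₂ x) (adjacent : Adjacent Y₁ Y₂)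
        {t : ℕ} (leaf : Fin (suc t) → Fin n) (leaf-injective : ∀ i j → leaf i ≡ leaf j → i ≡ j)
        (is-leaf : ∀ i → Leaf X (leaf i)) where

        -- One leaf stays in the hub: it makes the hub adjacent to both Grow X Y₁ and Grow X Y₂.
        Hub : Fin n → Set
        Hub x = X x × (x ≡ leaf zero ⊎ ¬ Leaf X x)

        -- A parent has a child and so is no leaf. This makes the hub closed under `up`, hence
        -- connected, and attaches every leaf to it.
        up∈Hub : ∀ {x} → X x → x ≢ ρ → Hub (up x)
        up∈Hub {x} Xx x≢ρ = up-closed tree Xx x≢ρ , inj₂ (λ (_ , _ , childless) → childless (x , Xx , x≢ρ , refl))

        hub-connected : Connected Hub
        hub-connected = connected-to-root tree proj₁ (up∈Hub ∘ proj₁)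

        leaf₀∈Hub : Hub (leaf zero)
        leaf₀∈Hub = proj₁ (is-leaf zero) , inj₁ refl

        leaf∉Hub : ∀ i → ¬ Hub (leaf (suc i))
        leaf∉Hub i (_ , inj₁ eq)    = contradiction (leaf-injective _ _ eq) λ ()
        leaf∉Hub i (_ , inj₂ ¬leaf) = ¬leaf (is-leaf (suc i))

        branch : Fin (3 + t) → Fin n → Set
        branch zero                = Grow X Y₁
        branch (suc zero)          = Grow X Y₂
        branch (suc (suc zero))    = Hub
        branch (suc (suc (suc i))) = _≡ leaf (suc i)

        grow∌X : ∀ {Y x} → (∀ {x} → Y x → ¬ K x) → Grow X Y x → ¬ X x
        grow∌X avoids (inj₁ y) Xx = avoids y (inside tree Xx)
        grow∌X avoids (inj₂ f) Xx = fringe∉X f Xx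

        grows-apart : ∀ {x} → Grow X Y₁ x → ¬ Grow X Y₂ x
        grows-apart (inj₁ y₁) (inj₁ y₂) = apart y₁ y₂
        grows-apart (inj₁ y₁) (inj₂ f₂) = avoids₁ y₁ (fringe⊆K f₂)
        grows-apart (inj₂ f₁) (inj₁ y₂) = avoids₂ y₂ (fringe⊆K f₁)
        -- Two fringes that meet share a component, and that component would see both sides.
        grows-apart (inj₂ (a , touch-a , r)) (inj₂ (b , touch-b , r′)) =
          separates (b , (a , touch-a , reach-trans r (reach-sym r′)) , touch-b)

        leaf∈X : ∀ i {x} → x ≡ leaf i → X x
        leaf∈X i refl = proj₁ (is-leaf i)

        disjoint : ∀ i j x → branch i x → branch j x → i ≡ j
        disjoint zero zero x p q = refl
        disjoint zero (suc zero) x p q = contradiction q (grows-apart p)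
        disjoint zero (suc (suc zero)) x p q = contradiction (proj₁ q) (grow∌X avoids₁ p)
        disjoint zero (suc (suc (suc j))) x p q = contradiction (leaf∈X (suc j) q) (grow∌X avoids₁ p)
        disjoint (suc zero) zero x p q = contradiction p (grows-apart q)
        disjoint (suc zero) (suc zero) x p q = refl
        disjoint (suc zero) (suc (suc zero)) x p q = contradiction (proj₁ q) (grow∌X avoids₂ p)
        disjoint (suc zero) (suc (suc (suc j))) x p q = contradiction (leaf∈X (suc j) q) (grow∌X avoids₂ p)
        disjoint (suc (suc zero)) zero x p q = contradiction (proj₁ p) (grow∌X avoids₁ q)
        disjoint (suc (suc zero)) (suc zero) x p q = contradiction (proj₁ p) (grow∌X avoids₂ q)
        disjoint (suc (suc zero)) (suc (suc zero)) x p q = refl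
        disjoint (suc (suc zero)) (suc (suc (suc j))) x p refl = contradiction p (leaf∉Hub j)
        disjoint (suc (suc (suc i))) zero x p q = contradiction (leaf∈X (suc i) p) (grow∌X avoids₁ q)
        disjoint (suc (suc (suc i))) (suc zero) x p q = contradiction (leaf∈X (suc i) p) (grow∌X avoids₂ q)
        disjoint (suc (suc (suc i))) (suc (suc zero)) x refl q = contradiction q (leaf∉Hub i)
        disjoint (suc (suc (suc i))) (suc (suc (suc j))) x refl q =
          cong {A = Fin (suc t)} (λ k → suc (suc k)) (leaf-injective (suc i) (suc j) q)

        branch-connected : ∀ i → Connected (branch i)
        branch-connected zero                = grow-connected connected₁
        branch-connected (suc zero)          = grow-connected connected₂
        branch-connected (suc (suc zero))    = hub-connected
        branch-connected (suc (suc (suc i))) = singleton-connected (leaf (suc i))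

        nonempty : ∀ i → ∃ (branch i)
        nonempty zero = let y₁ , Yy₁ , _ = adjacent in y₁ , inj₁ Yy₁
        nonempty (suc zero) = let _ , _ , y₂ , Yy₂ , _ = adjacent in y₂ , inj₁ Yy₂
        nonempty (suc (suc zero)) = leaf zero , leaf₀∈Hub
        nonempty (suc (suc (suc i))) = leaf (suc i) , refl

        grows-adjacent : Adjacent (Grow X Y₁) (Grow X Y₂)
        grows-adjacent = adjacent-mono inj₁ inj₁ adjacent

        hub-adjacent₁ : Adjacent Hub (Grow X Y₁)
        hub-adjacent₁ = leaf zero , leaf₀∈Hub , leaf-touches₁ (is-leaf zero)

        hub-adjacent₂ : Adjacent Hub (Grow X Y₂)
        hub-adjacent₂ = leaf zero , leaf₀∈Hub , leaf-touches₂ (is-leaf zero)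

        leaf-adjacent₁ : ∀ i → Adjacent (_≡ leaf i) (Grow X Y₁)
        leaf-adjacent₁ i = leaf i , refl , leaf-touches₁ (is-leaf i)

        leaf-adjacent₂ : ∀ i → Adjacent (_≡ leaf i) (Grow X Y₂)
        leaf-adjacent₂ i = leaf i , refl , leaf-touches₂ (is-leaf i)

        leaf-adjacent-hub : ∀ i → Adjacent (_≡ leaf i) Hub
        leaf-adjacent-hub i with Xl , l≢ρ , _ ← is-leaf i =
          leaf i , refl , up (leaf i) , up∈Hub Xl l≢ρ , up-adj (inside tree Xl) l≢ρ

        branch-adjacent : ∀ i j → Adj (K3t* t) i j → Adjacent (branch i) (branch j)
        branch-adjacent zero zero ()
        branch-adjacent zero (suc zero) _ = grows-adjacent
        branch-adjacent zero (suc (suc zero)) _ = adjacent-sym hub-adjacent₁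
        branch-adjacent zero (suc (suc (suc j))) _ = adjacent-sym (leaf-adjacent₁ (suc j))
        branch-adjacent (suc zero) zero _ = adjacent-sym grows-adjacent
        branch-adjacent (suc zero) (suc zero) ()
        branch-adjacent (suc zero) (suc (suc zero)) _ = adjacent-sym hub-adjacent₂
        branch-adjacent (suc zero) (suc (suc (suc j))) _ = adjacent-sym (leaf-adjacent₂ (suc j))
        branch-adjacent (suc (suc zero)) zero _ = hub-adjacent₁
        branch-adjacent (suc (suc zero)) (suc zero) _ = hub-adjacent₂
        branch-adjacent (suc (suc zero)) (suc (suc zero)) ()
        branch-adjacent (suc (suc zero)) (suc (suc (suc j))) _ = adjacent-sym (leaf-adjacent-hub (suc j))
        branch-adjacent (suc (suc (suc i))) zero _ = leaf-adjacent₁ (suc i)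
        branch-adjacent (suc (suc (suc i))) (suc zero) _ = leaf-adjacent₂ (suc i)
        branch-adjacent (suc (suc (suc i))) (suc (suc zero)) _ = leaf-adjacent-hub (suc i)
        -- Both indices are at least 3, so the adjacency Boolean is a conjunction with `false`.
        branch-adjacent (suc (suc (suc i))) (suc (suc (suc j))) e = ⊥-elim (subst T (∧-zeroʳ _) e)

        minor : IsMinor (K3t* t) G
        minor = record
          { branch    = branch
          ; nonempty  = nonempty
          ; disjoint  = disjoint
          ; connected = λ i x y p q → connected-within (branch-connected i q p)
          ; edges     = λ i j e → let x , p , y , q , xy = branch-adjacent i j e in x , y , p , q , xy
          }

    -- Covering a subtree by strands.

    module _ {X : Fin n → Set} (X? : Decidable X) (tree : Subtree X) where

      leaves : List (Fin n)
      leaves = filter (leaf? X?) (allFin n)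

      -- The constant strand covers the root, also when the tree has no leaf; it accounts for the
      -- one strand beyond the number of leaves.
      strands : List (ℕ → Fin n)
      strands = (λ _ → ρ) ∷ map branch-to leaves

      strand-through : ∀ {x} → X x → ∃[ z ] z ∈ strands × z (level x) ≡ x
      strand-through {x} Xx with x ≟ᶠ ρ
      ... | yes x≡ρ = (λ _ → ρ) , here refl , sym x≡ρ
      ... | no x≢ρ with leaf-below X? tree Xx x≢ρ
      ...   | y , leaf , eq = branch-to y , there (∈-map⁺ branch-to (∈-filter⁺ (leaf? X?) (∈-allFin y) leaf)) , eq

      leaves-unique : Unique leaves
      leaves-unique = Uniqueₚ.filter⁺ (leaf? X?) (Uniqueₚ.allFin⁺ n)

      lookup-leaf : ∀ i → Leaf X (lookup leaves i)
      lookup-leaf i = proj₂ (∈-filter⁻ (leaf? X?) {xs = allFin n} (∈-lookup i))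

      length-strands-≤ : ∀ {t} → length leaves ≤ t → length strands ≤ suc t
      length-strands-≤ ≤t = s≤s (≤-trans (≤-reflexive (length-map branch-to leaves)) ≤t)

-- Building the decomposition

module _ {n : ℕ} {A : Set} {X : Fin n → Set} (X? : Decidable X) (a : A) (f : Fin n → A) where

  relabel : Fin n → A
  relabel x with X? x
  ... | yes _ = a
  ... | no _  = f x

  relabel-in : ∀ {x} → X x → relabel x ≡ a
  relabel-in {x} Xx with X? x
  ... | yes _  = refl
  ... | no ¬Xx = contradiction Xx ¬Xx

  relabel-out : ∀ {x} → ¬ X x → relabel x ≡ f x
  relabel-out {x} ¬Xx with X? x
  ... | yes Xx = contradiction Xx ¬Xx
  ... | no _   = refl

module Decompose {n : ℕ} (G : Graph n) {t : ℕ} (no-minor : ¬ IsMinor (K3t* t) G) where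

  Piece : Set
  Piece = Node n (suc t)

  record Side (K : Fin n → Set) : Set₁ where
    field
      Y          : Fin n → Set
      Y?         : Decidable Y
      Yconnected : Connected G Y
      avoids     : ∀ {x} → Y x → ¬ K x
      label      : Piece

  open Side

  On : ∀ {K} → (Fin n → Piece) → Side K → Fin n → Set
  On node s y = Y s y × node y ≡ label s

  -- K is the component of w in the unprocessed graph D. Each side is a connected set outside K,
  -- large enough for the two sides to be adjacent whenever K sees both; the neighbours of K
  -- on a side all lie in the single piece `label`.
  record State (D : Fin n → Set) (node : Fin n → Piece) (w : Fin n) : Set₁ where
    field
      K         : Fin n → Set
      K?        : Decidable K
      w∈K       : K w
      K⊆D       : ∀ {x} → K x → D x
      connected : Connected G K
      s₁ s₂     : Side K
      sees      : Seen (label s₁) (label s₂)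
      apart     : ∀ {x} → Y s₁ x → ¬ Y s₂ x
      linked    : Adjacent G K (Y s₁) → Adjacent G K (Y s₂) → Adjacent G (Y s₁) (Y s₂)
      boundary  : ∀ {x y} → K x → Adj G x y → K y ⊎ (¬ D y × (On node s₁ y ⊎ On node s₂ y))

  Remove : (Fin n → Set) → (Fin n → Set) → Fin n → Set
  Remove D X x = D x × ¬ X x

  remove? : ∀ {D X} → Decidable D → Decidable X → Decidable (Remove D X)
  remove? D? X? x = D? x ×-dec ¬? (X? x)

  -- The invariant `sees` of a state is what lets a single Boolean record the second piece that a
  -- new piece sees.
  viaParent : ∀ (i : Piece) {j} → Seen i j → Bool
  viaParent _ (inj₁ _) = true
  viaParent _ (inj₂ _) = false

  other-cut : ∀ level strands (≤m : length strands ≤ suc t) i {j} (sees : Seen i j) →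
    other (cut level strands ≤m (viaParent i sees) i) ≡ j
  other-cut _ _ _ _ (inj₁ eq) = sym eq
  other-cut _ _ _ _ (inj₂ eq) = sym eq

  record Step {D node u} (state : State D node u) : Set₁ where
    open State state
    field
      X            : Fin n → Set
      X?           : Decidable X
      X⊆K          : ∀ {x} → X x → K x
      occupied     : ∃ X
      piece        : Piece
      parent-piece : parent piece ≡ label s₁
      other-piece  : other piece ≡ label s₂
      fits         : ∀ {x} → X x → Fits G piece K x
      next         : ∀ {w} → K w → ¬ X w → State (Remove D X) (relabel X? piece node) w

  module MakeStep {D node u} (state : State D node u) {ρ : Fin n} (ρ∈K : State.K state ρ) where

    open State state
    open BFS G K? connected ρ∈K

    module _ {X : Fin n → Set} (X? : Decidable X) (tree : Subtree X)
      (few : length (leaves X? tree) ≤ t) where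

      piece : Piece
      piece = cut level (strands X? tree) (length-strands-≤ X? tree few) (viaParent (label s₁) sees) (label s₁)

      other-piece : other piece ≡ label s₂
      other-piece = other-cut level (strands X? tree) (length-strands-≤ X? tree few) (label s₁) sees

      Rest : Fin n → Fin n → Set
      Rest = Reach G (Outside X)

      -- Common to both kinds of cut: the component of `w` in K - X gets a new side `Q` around `X`,
      -- labelled by the new piece, and keeps one old side. `only` rules out neighbours that lie on
      -- the dropped side alone.
      child : ∀ {w} → K w → ¬ X w → (kept : Side K) → Seen piece (label kept) →
        ∀ {Q} → Decidable Q → Connected G Q → (∀ {x} → X x → Q x) →
        (∀ {x} → Q x → ¬ Rest w x) → (∀ {x} → Q x → ¬ Y kept x) →
        (∀ {x y} → Rest w x → Adj G x y → On node s₁ y ⊎ On node s₂ y → On node kept y) →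
        (Adjacent G (Rest w) (Y kept) → Adjacent G Q (Y kept)) →
        State (Remove D X) (relabel X? piece node) w
      child {w} Kw ¬Xw kept seen {Q} Q? Qconnected X⊆Q Qavoids Qapart only link = record
        { K         = Rest w
        ; K?        = reach? G (outside? X?) w
        ; w∈K       = reach-refl G (Kw , ¬Xw)
        ; K⊆D       = λ r → K⊆D (proj₁ (reach-end G r)) , proj₂ (reach-end G r)
        ; connected = component-connected G w
        ; s₁        = record { Y = Q ; Y? = Q? ; Yconnected = Qconnected ; avoids = Qavoids ; label = piece }
        ; s₂        = record { Y = Y kept ; Y? = Y? kept ; Yconnected = Yconnected kept ; label = label kept
                             ; avoids = λ y r → avoids kept y (proj₁ (reach-end G r)) }
        ; sees      = seen
        ; apart     = Qapart
        ; linked    = λ _ → link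
        ; boundary  = boundary′
        }
        where
        boundary′ : ∀ {x y} → Rest w x → Adj G x y → Rest w y ⊎ (¬ Remove D X y ×
          ((Q y × relabel X? piece node y ≡ piece) ⊎ (Y kept y × relabel X? piece node y ≡ label kept)))
        boundary′ {y = y} r xy = by-membership (boundary (proj₁ (reach-end G r)) xy) (X? y)
          where
          by-membership : K y ⊎ (¬ D y × (On node s₁ y ⊎ On node s₂ y)) → Dec (X y) → Rest w y ⊎ (¬ Remove D X y ×
            ((Q y × relabel X? piece node y ≡ piece) ⊎ (Y kept y × relabel X? piece node y ≡ label kept)))
          -- Vertices of `X` are now processed and carry the new label, so they count for the side
          -- `Q`.
          by-membership _ (yes Xy) = inj₂ ((λ Dy → proj₂ Dy Xy) , inj₁ (X⊆Q Xy , relabel-in X? piece node Xy))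
          by-membership (inj₁ Ky) (no ¬Xy) = inj₁ (reach-snoc G r xy (Ky , ¬Xy))
          by-membership (inj₂ (¬Dy , on)) (no ¬Xy) =
            let y∈ , eq = only r xy on in inj₂ (¬Dy ∘ proj₁ , inj₂ (y∈ , trans (relabel-out X? piece node ¬Xy) eq))

      step : (∀ {w} → K w → ¬ X w → State (Remove D X) (relabel X? piece node) w) → Step state
      step next = record
        { X = X ; X? = X? ; X⊆K = Subtree.inside tree ; occupied = ρ , Subtree.rooted tree
        ; piece = piece ; parent-piece = refl ; other-piece = other-piece
        ; fits = λ Xx → level-lipschitz , strand-through X? tree Xx
        ; next = next
        }

      seen₁ : Seen piece (label s₁)
      seen₁ = inj₁ refl

      seen₂ : Seen piece (label s₂)
      seen₂ = inj₂ (sym other-piece)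

    -- For a component seeing at most one side, one vertex is cut. Choosing it next to the kept
    -- side, if that side is seen, makes the two new sides adjacent.
    module Single (kept : Side K) (touch : Adjacent G K (Y kept) → Touches G (Y kept) ρ) where

      tree : Subtree (_≡ ρ)
      tree = record
        { inside    = λ { refl → ρ∈K }
        ; rooted    = refl
        ; up-closed = λ x≡ρ x≢ρ → contradiction x≡ρ x≢ρ
        }

      X? : Decidable (_≡ ρ)
      X? = _≟ᶠ ρ

      few : length (leaves X? tree) ≤ t
      few = ≮⇒≥ λ lt → let x≡ρ , x≢ρ , _ = lookup-leaf X? tree (fromℕ< (≤-trans (s≤s z≤n) lt)) in x≢ρ x≡ρ

      single : Seen (piece X? tree few) (label kept) →
        (∀ {x y} → K x → Adj G x y → On node s₁ y ⊎ On node s₂ y → On node kept y) → Step state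
      single seen only = step X? tree few λ Kw ¬Xw →
        child X? tree few Kw ¬Xw kept seen X? (singleton-connected G ρ) id
          (λ { refl r → proj₂ (reach-end G r) refl })
          (λ { refl y → avoids kept y ρ∈K })
          (λ r → only (proj₁ (reach-end G r)))
          (λ (x , r , touch-x) → ρ , refl , touch (x , proj₁ (reach-end G r) , touch-x))

    module Double (adj₁ : Adjacent G K (Y s₁)) (adj₂ : Adjacent G K (Y s₂)) where

      sep : Separator (Y s₁) (Y s₂)
      sep = separator (Y? s₁) (Y? s₂)

      open Separator sep

      few : length (leaves X? tree) ≤ t
      -- With more than `t` leaves, the first t + 1 entries of the duplicate-free list of leaves
      -- yield the forbidden minor.
      few = ≮⇒≥ λ lt → no-minor (Minor.minor sep (Yconnected s₁) (Yconnected s₂) (avoids s₁) (avoids s₂)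
        apart (linked adj₁ adj₂)
        (λ i → lookup (leaves X? tree) (inject≤ i lt))
        (λ i j eq → inject≤-injective lt lt i j (unique-lookup-injective (leaves-unique X? tree) _ _ eq))
        (λ i → lookup-leaf X? tree (inject≤ i lt)))

      -- The side that the new component does not see is absorbed, together with X and the
      -- components touching it, into the new side.
      absorb : ∀ {w} → K w → ¬ X w → (lost kept : Side K) → Seen (piece X? tree few) (label kept) →
        Adjacent G K (Y lost) → ¬ Adjacent G (Rest X? tree few w) (Y lost) →
        (∀ {x} → Y lost x → ¬ Y kept x) → Adjacent G (Y lost) (Y kept) →
        (∀ {y} → On node s₁ y ⊎ On node s₂ y → On node lost y ⊎ On node kept y) →
        State (Remove D X) (relabel X? (piece X? tree few) node) w
      absorb {w} Kw ¬Xw lost kept seen adj unseen lost-apart lost-kept sort =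
        child X? tree few Kw ¬Xw kept seen
          (λ x → X? x ⊎-dec grow? X? (Y? lost) x)
          (connected-join G (connected-to-root tree id (Subtree.up-closed tree)) (grow-connected (Yconnected lost))
            (grow-adjacent X? tree adj))
          inj₁
          (λ { (inj₁ Xx) r → proj₂ (reach-end G r) Xx
             ; (inj₂ (inj₁ y)) r → avoids lost y (proj₁ (reach-end G r))
             ; (inj₂ (inj₂ (a , touch , ax))) r → unseen (a , reach-trans G r (reach-sym G ax) , touch)
             })
          (λ { (inj₁ Xx) y → avoids kept y (Subtree.inside tree Xx)
             ; (inj₂ (inj₁ y′)) y → lost-apart y′ y
             ; (inj₂ (inj₂ f)) y → avoids kept y (fringe⊆K f)
             })
          (λ {x} {y} r xy on → keep r xy (sort on))
          (λ _ → adjacent-mono G (inj₂ ∘ inj₁) id lost-kept)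
        where
        keep : ∀ {x y} → Rest X? tree few w x → Adj G x y → On node lost y ⊎ On node kept y → On node kept y
        keep r xy (inj₁ (y∈ , _)) = contradiction (_ , r , _ , y∈ , xy) unseen
        keep r xy (inj₂ on)       = on

      double : Step state
      double = step X? tree few next
        where
        next : ∀ {w} → K w → ¬ X w → State (Remove D X) (relabel X? (piece X? tree few) node) w
        next {w} Kw ¬Xw with adjacent? G (reach? G (outside? X?) w) (Y? s₂)
        ... | no unseen = absorb Kw ¬Xw s₂ s₁ (seen₁ X? tree few) adj₂ unseen (λ y₂ y₁ → apart y₁ y₂)
                            (adjacent-sym G (linked adj₁ adj₂)) swap
        -- A component that sees the second side cannot see the first, as `X` separates them.
        ... | yes (b , wb , touch-b) = absorb Kw ¬Xw s₁ s₂ (seen₂ X? tree few) adj₁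
            (λ (a , wa , touch-a) → separates (b , (a , touch-a , reach-trans G (reach-sym G wa) wb) , touch-b))
            apart (linked adj₁ adj₂) id

  module _ {D node u} (state : State D node u) where

    open State state

    attachment : ∀ (s : Side K) → ∃[ ρ ] K ρ × (Adjacent G K (Y s) → Touches G (Y s) ρ)
    attachment s with adjacent? G K? (Y? s)
    ... | yes (x , Kx , touch) = x , Kx , λ _ → touch
    -- The side is not seen, so the requirement is vacuous and any vertex of `K` will do.
    ... | no unseen            = u , w∈K , λ adj → contradiction adj unseen

    abstract
      make-step : Step state
      make-step with adjacent? G K? (Y? s₁) | adjacent? G K? (Y? s₂)
      ... | no unseen | _ with attachment s₂
      ...   | ρ , ρ∈K , touch = M.single (MakeStep.seen₂ state ρ∈K M.X? M.tree M.few)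
              λ { Kx xy (inj₁ (y∈ , _)) → contradiction (_ , Kx , _ , y∈ , xy) unseen ; Kx xy (inj₂ on) → on }
        where module M = MakeStep.Single state ρ∈K s₂ touch
      make-step | yes adj₁ | no unseen with attachment s₁
      ...   | ρ , ρ∈K , touch = M.single (MakeStep.seen₁ state ρ∈K M.X? M.tree M.few)
              λ { Kx xy (inj₂ (y∈ , _)) → contradiction (_ , Kx , _ , y∈ , xy) unseen ; Kx xy (inj₁ on) → on }
        where module M = MakeStep.Single state ρ∈K s₁ touch
      make-step | yes adj₁ | yes adj₂ = MakeStep.Double.double state w∈K adj₁ adj₂

    -- Every edge leaving `K` ends at a processed vertex, so a walk through unprocessed vertices
    -- that starts in `K` is trapped there.
    absorbs : ∀ {P x y} → (∀ {z} → P z → D z) → K x → Reach G P x y → K y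
    absorbs P⊆D Kx (_ , nil _) = Kx
    absorbs P⊆D Kx (_ , snoc w yz p) with boundary (absorbs P⊆D Kx (_ , w)) yz
    ... | inj₁ Kz        = Kz
    ... | inj₂ (¬Dz , _) = contradiction (P⊆D p) ¬Dz

  -- One round: cutting a piece and restoring the invariants.

  module Advance {D : Fin n → Set} {now : ℕ} {time : Fin n → ℕ} {node : Fin n → Piece}
    (past : ∀ {v} → ¬ D v → time v < now) (certificates : ∀ {v} → ¬ D v → Certificate G D time node v)
    (states : ∀ w → D w → State D node w) {u : Fin n} (Du : D u) where

    open State (states u Du)
    open Step (make-step (states u Du)) public

    D′ : Fin n → Set
    D′ = Remove D X

    time′ : Fin n → ℕ
    time′ = relabel X? now time

    node′ : Fin n → Piece
    node′ = relabel X? piece node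

    X⊆D : ∀ {x} → X x → D x
    X⊆D = K⊆D ∘ X⊆K

    processed : ∀ {v} → ¬ D′ v → ¬ X v → ¬ D v
    processed ¬D′v ¬Xv Dv = ¬D′v (Dv , ¬Xv)

    fresh : ∀ {v} → ¬ D v → ¬ X v
    fresh ¬Dv Xv = ¬Dv (X⊆D Xv)

    old-time : ∀ {v} → ¬ D v → time′ v ≡ time v
    old-time ¬Dv = relabel-out X? now time (fresh ¬Dv)

    old-node : ∀ {v} → ¬ D v → node′ v ≡ node v
    old-node ¬Dv = relabel-out X? piece node (fresh ¬Dv)

    past′ : ∀ {v} → ¬ D′ v → time′ v < suc now
    past′ {v} ¬D′v with X? v
    ... | yes _  = n<1+n now
    ... | no ¬Xv = m<n⇒m<1+n (past (processed ¬D′v ¬Xv))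

    new-certificate : ∀ {v} → X v → Certificate G D′ time′ node′ v
    new-certificate {v} Xv = record
      { zone   = K
      ; self∈  = X⊆K Xv
      ; closed = closed′
      ; same   = same′
      ; fits   = subst (λ i → Fits G i K v) (sym node-v) (fits Xv)
      }
      where
      node-v : node′ v ≡ piece
      node-v = relabel-in X? piece node Xv
      seen : ∀ {y} → ¬ D y → On node s₁ y ⊎ On node s₂ y → Seen (node′ v) (node′ y)
      seen ¬Dy on rewrite node-v | old-node ¬Dy with on
      ... | inj₁ (_ , eq) = inj₁ (trans eq (sym parent-piece))
      ... | inj₂ (_ , eq) = inj₂ (trans eq (sym other-piece))
      closed′ : ∀ {x y} → K x → Adj G x y → K y ⊎ (¬ D′ y × time′ y < time′ v × Seen (node′ v) (node′ y))
      closed′ Kx xy with boundary Kx xy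
      ... | inj₁ Ky         = inj₁ Ky
      ... | inj₂ (¬Dy , on) = inj₂ (¬Dy ∘ proj₁ ,
              subst₂ _<_ (sym (old-time ¬Dy)) (sym (relabel-in X? now time Xv)) (past ¬Dy) , seen ¬Dy on)
      same′ : ∀ {x} → K x → ¬ D′ x → time′ x ≤ time′ v → node′ x ≡ node′ v
      same′ {x} Kx ¬D′x _ with X? x
      ... | yes _  = sym node-v
      -- All of `K` was unprocessed before this round, so its only processed vertices are those of
      -- `X`.
      ... | no ¬Xx = contradiction (K⊆D Kx) (processed ¬D′x ¬Xx)

    old-certificate : ∀ {v} → ¬ D v → Certificate G D′ time′ node′ v
    old-certificate {v} ¬Dv = record
      { zone   = zone
      ; self∈  = self∈
      ; closed = closed′
      ; same   = same′
      ; fits   = subst (λ i → Fits G i zone v) (sym (old-node ¬Dv)) old-fits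
      }
      where
      open Certificate (certificates ¬Dv) renaming (fits to old-fits)
      closed′ : ∀ {x y} → zone x → Adj G x y → zone y ⊎ (¬ D′ y × time′ y < time′ v × Seen (node′ v) (node′ y))
      closed′ zx xy with closed zx xy
      ... | inj₁ zy                = inj₁ zy
      ... | inj₂ (¬Dy , lt , seen) = inj₂ (¬Dy ∘ proj₁ ,
              subst₂ _<_ (sym (old-time ¬Dy)) (sym (old-time ¬Dv)) lt ,
              subst₂ Seen (sym (old-node ¬Dv)) (sym (old-node ¬Dy)) seen)
      same′ : ∀ {x} → zone x → ¬ D′ x → time′ x ≤ time′ v → node′ x ≡ node′ v
      same′ {x} zx ¬D′x le rewrite old-time ¬Dv | old-node ¬Dv with X? x
      -- The new piece is stamped `now`, later than the old vertex `v`, so the hypothesis on times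
      -- fails.
      ... | yes _  = contradiction (past ¬Dv) (≤⇒≯ le)
      ... | no ¬Xx = same zx (processed ¬D′x ¬Xx) le

    certificates′ : ∀ {v} → ¬ D′ v → Certificate G D′ time′ node′ v
    certificates′ {v} ¬D′v = by-membership (X? v)
      where
      by-membership : Dec (X v) → Certificate G D′ time′ node′ v
      by-membership (yes Xv) = new-certificate Xv
      by-membership (no ¬Xv) = old-certificate (processed ¬D′v ¬Xv)

    old-state : ∀ w → D w → ¬ K w → State D′ node′ w
    old-state w Dw ¬Kw = record
      { K = S.K ; K? = S.K? ; w∈K = S.w∈K ; connected = S.connected
      -- Another component cannot meet `X`: it would be connected to `K` through unprocessed
      -- vertices, placing `w` in `K`.
      ; K⊆D = λ Sx → S.K⊆D Sx , λ Xx → ¬Kw (absorbs (states u Du) S.K⊆D (X⊆K Xx) (S.connected Sx S.w∈K))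
      ; s₁ = S.s₁ ; s₂ = S.s₂ ; sees = S.sees ; apart = S.apart ; linked = S.linked
      ; boundary = boundary′
      }
      where
      module S = State (states w Dw)
      boundary′ : ∀ {x y} → S.K x → Adj G x y → S.K y ⊎ (¬ D′ y × (On node′ S.s₁ y ⊎ On node′ S.s₂ y))
      boundary′ Sx xy with S.boundary Sx xy
      ... | inj₁ Sy = inj₁ Sy
      ... | inj₂ (¬Dy , inj₁ (Yy , eq)) = inj₂ (¬Dy ∘ proj₁ , inj₁ (Yy , trans (old-node ¬Dy) eq))
      ... | inj₂ (¬Dy , inj₂ (Yy , eq)) = inj₂ (¬Dy ∘ proj₁ , inj₂ (Yy , trans (old-node ¬Dy) eq))

    states′ : ∀ w → D′ w → State D′ node′ w
    states′ w (Dw , ¬Xw) with K? w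
    ... | yes Kw = next Kw ¬Xw
    ... | no ¬Kw = old-state w Dw ¬Kw

  -- Pieces are nonempty, so the number of unprocessed vertices drops. The certificate conditions on
  -- times and nodes concern processed vertices only and survive later cuts, whose time stamps are
  -- larger.
  decompose : ∀ {D} (D? : Decidable D) → Acc _<_ (size D?) → ∀ {now time node} →
    (∀ {v} → ¬ D v → time v < now) → (∀ {v} → ¬ D v → Certificate G D time node v) →
    (∀ w → D w → State D node w) →
    ∃[ time′ ] ∃[ node′ ] ((v : Fin n) → Certificate {m = suc t} G (λ _ → ⊥) time′ node′ v)
  decompose {D} D? (acc rec) {now} {time} {node} past certificates states with any? D?
  ... | yes (u , Du) = decompose (remove? D? A.X?)
          (rec (size-mono-< (remove? D? A.X?) D? (λ _ → proj₁) (A.X⊆D (proj₂ A.occupied)) (λ D′x → proj₂ D′x (proj₂ A.occupied))))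
          A.past′ A.certificates′ A.states′
    where module A = Advance past certificates states Du
  ... | no empty = time , node , λ v → finish v
    where
    finish : ∀ v → Certificate G (λ _ → ⊥) time node v
    finish v = record
      { zone = zone ; self∈ = self∈ ; fits = fits
      ; closed = λ zx xy → relax (closed zx xy)
      ; same = λ {x} zx _ → same zx (λ Dx → empty (x , Dx))
      }
      where
      open Certificate (certificates {v} (λ Dv → empty (v , Dv)))
      relax : ∀ {A B : Set} {y} → A ⊎ (¬ D y × B) → A ⊎ (¬ ⊥ × B)
      relax (inj₁ a)       = inj₁ a
      relax (inj₂ (_ , b)) = inj₂ (id , b)

  -- No piece exists yet: both sides are empty and share the dummy label `root`, which sees itself.
  initial : ∀ w → ⊤ → State (λ _ → ⊤) (λ _ → root) w
  initial w _ = record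
    { K = Reach G (λ _ → ⊤) w ; K? = reach? G (λ _ → yes tt) w ; w∈K = reach-refl G tt ; K⊆D = λ _ → tt
    ; connected = component-connected G w
    ; s₁ = nothing ; s₂ = nothing ; sees = inj₁ refl ; apart = λ ()
    ; linked = λ { (_ , _ , _ , () , _) }
    ; boundary = λ r xy → inj₁ (reach-snoc G r xy tt)
    }
    where
    nothing : Side (Reach G (λ _ → ⊤) w)
    nothing = record { Y = λ _ → ⊥ ; Y? = λ _ → no id ; Yconnected = λ () ; avoids = λ () ; label = root }

  decomposition : ∃[ time ] ∃[ node ] ((v : Fin n) → Certificate {m = suc t} G (λ _ → ⊥) time node v)
  decomposition = decompose {λ _ → ⊤} (λ _ → yes tt) (<-wellFounded _) {0} {λ _ → 0}
    (λ ¬⊤ → contradiction tt ¬⊤) (λ ¬⊤ → contradiction tt ¬⊤) initial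

theorem25 : ∀ (t : ℕ) → 1 ≤ t → ∀ {n : ℕ} (G : Graph n) → ¬ IsMinor (K3t* t) G →
    ∀ (r : ℕ) → 1 ≤ r →
    scol≤ G r (3 * (2 * t + 1) * (2 * r + 1))
    × wcol≤ G r ((2 * t + 1) * ((r + 2) C 2) * (2 * r + 1))
theorem25 t _ G no-minor r _ with Decompose.decomposition G no-minor
... | time , node , certificate =
  weaken scol (scol-bound r) , weaken wcol (wcol-bound r)
  where
  open Bounds G time node certificate using (scol-bound; wcol-bound)
  open ≤-Reasoning
  R = 2 * r + 1
  weaken : ∀ {P : Fin _ → Fin _ → Ordering _ → Set} {k l} → k ≤ l →
    Σ (Ordering _) (λ σ → ∀ v → CardAtMost (λ x → P v x σ) k) →
    Σ (Ordering _) (λ σ → ∀ v → CardAtMost (λ x → P v x σ) l)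
  weaken k≤l (σ , bound) = σ , λ v xs uniq all → ≤-trans (bound v xs uniq all) k≤l
  -- A piece has at most t + 1 strands, one for the root and one for each of at most `t` leaves.
  strands≤ : suc t ≤ 2 * t + 1
  strands≤ = subst (_≤ 2 * t + 1) (+-comm t 1) (+-monoˡ-≤ 1 (m≤m+n t (t + 0)))
  scol : 3 * (suc t * R) ≤ 3 * (2 * t + 1) * R
  scol = begin
    3 * (suc t * R)       ≡⟨ *-assoc 3 (suc t) R ⟨
    3 * suc t * R         ≤⟨ *-monoˡ-≤ R (*-monoʳ-≤ 3 strands≤) ⟩
    3 * (2 * t + 1) * R   ∎
  wcol : ((r + 2) C 2) * (suc t * R) ≤ (2 * t + 1) * ((r + 2) C 2) * R
  wcol = begin
    ((r + 2) C 2) * (suc t * R)         ≡⟨ *-assoc ((r + 2) C 2) (suc t) R ⟨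
    ((r + 2) C 2) * suc t * R           ≡⟨ cong (_* R) (*-comm ((r + 2) C 2) (suc t)) ⟩
    suc t * ((r + 2) C 2) * R           ≤⟨ *-monoˡ-≤ R (*-monoˡ-≤ ((r + 2) C 2) strands≤) ⟩
    (2 * t + 1) * ((r + 2) C 2) * R     ∎
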